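{- For every integer $n \ge 9$, the set $S = \{u_0, u_1, \dots, u_7\}$ is a zero forcing set of the generalized Petersen graph $P(n,3)$. Hence $Z(P(n,3)) \le 8$ for all $n \ge 9$.
   Context: Let $G=(V,E)$ be a finite simple graph. Color a subset $S\subseteq V$ black and the remaining vertices white. Color change rule: a black vertex with exactly one white neighbor forces that neighbor to become black. Iterating this rule starting from $S$ until no further force is possible gives the closure $\mathrm{cl}(S)$. The set $S$ is a zero forcing set of $G$ if $\mathrm{cl}(S)=V$, and the zero forcing number $Z(G)$ is the minimum cardinality of a zero forcing set. For $n\ge 3$ and $1\le k<n/2$, the generalized Petersen graph $P(n,k)$ has the $2n$ vertices $\{u_0,\dots,u_{n-1}\}\cup\{v_0,\dots,v_{n-1}\}$ and edges $u_i\sim u_{i+1}$, $u_i\sim v_i$, and $v_i\sim v_{i+k}$ for all $i$, with indices taken modulo $n$. -}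

module Defs where

open import Data.Fin.Base using (Fin; toℕ; splitAt; _↑ˡ_; _↑ʳ_)
open import Data.Fin.Properties using (any?; all?; toℕ<n; toℕ-fromℕ<) renaming (_≟_ to _≟ᶠ_)
open import Data.Bool.Properties using () renaming (_≟_ to _≟ᵇ_)
open import Data.Fin.Subset using (Subset; _∈_; _∉_; _⊆_; _⊃_; ⊤; ⁅_⁆; _∪_; ∣_∣)
open import Data.Fin.Subset.Induction using (⊃-wellFounded)
open import Data.Fin.Subset.Properties using (_∈?_; anySubset?; ⊆-antisym; ⊆-max; p⊆p∪q; q⊆p∪q; x∈p∪q⁻; x∈⁅x⁆; x∈⁅y⁆⇒x≡y)
open import Data.Nat.Base using (ℕ; _+_; _*_; _∸_; _≤_; _<_; z≤n; s≤s; NonZero; >-nonZero)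
open import Data.Nat.DivMod using (_%_; _mod_; m%n<n; m<n⇒m%n≡m; m≤n⇒[n∸m]%m≡n%m)
open import Data.Nat.Induction using (<-wellFounded)
open import Data.Nat.Properties using (_<?_; ≤-trans; ≤-<-trans; <-≤-trans; <⇒≢; <⇒≤; ≮⇒≥; m≤m+n; m+[n∸m]≡n; +-comm; +-cancelˡ-≡; +-monoˡ-<; +-monoʳ-≤; m<n+o⇒m∸n<o)
open import Data.Product.Base using (∃; ∃-syntax; _×_; _,_; proj₁; proj₂)
open import Data.Sum.Base using (_⊎_; inj₁; inj₂)
open import Data.Sum.Properties using (inj₁-injective; inj₂-injective)
open import Data.Vec.Properties using (≡-dec)
open import Function.Base using (_∘_)
open import Induction.WellFounded using (Acc; acc)
open import Relation.Binary.Construct.Closure.ReflexiveTransitive using (Star; ε; _◅_)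
open import Relation.Binary.Construct.Closure.Symmetric using (SymClosure; fwd; bwd; symmetric)
open import Relation.Binary.Definitions using (Decidable; Symmetric)
open import Relation.Binary.PropositionalEquality using (_≡_; _≢_; refl; sym; trans; cong; subst; module ≡-Reasoning)
open import Relation.Nullary using (¬_; Dec; yes; no; contradiction)
open import Relation.Nullary.Decidable using (map′; _×-dec_; _⊎-dec_; _→-dec_; ¬?)

record Graph : Set₁ where
  field
    order  : ℕ
    Adj    : Fin order → Fin order → Set
    adj?   : Decidable Adj
    symm   : Symmetric Adj
    irrefl : ∀ {x} → ¬ Adj x x

-- A set of vertices stands for the colouring in which its members are black
-- and all other vertices are white.

module ZeroForcing (G : Graph) where
  open Graph G

  Forces : Subset order → Fin order → Fin order → Set
  Forces B x y = x ∈ B × Adj x y × y ∉ B × (∀ z → Adj x z → z ∉ B → z ≡ y)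

  data Step (B : Subset order) : Subset order → Set where
    force : ∀ {x y} → Forces B x y → Step B (B ∪ ⁅ y ⁆)

  Stalled : Subset order → Set
  Stalled B = ∀ x y → ¬ Forces B x y

  IsClosure : Subset order → Subset order → Set
  IsClosure S C = Star Step S C × Stalled C

  forces? : ∀ B x y → Dec (Forces B x y)
  forces? B x y =
    x ∈? B ×-dec adj? x y ×-dec ¬? (y ∈? B) ×-dec
    all? (λ z → adj? x z →-dec ¬? (z ∈? B) →-dec z ≟ᶠ y)

  closure-exists : ∀ S → ∃ (IsClosure S)
  closure-exists S = go S (⊃-wellFounded S)
    where
    go : ∀ B → Acc _⊃_ B → ∃ (IsClosure B)
    go B (acc rs) with any? (λ x → any? (forces? B x))
    ... | no stalled = B , ε , λ x y f → stalled (x , y , f)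
    ... | yes (x , y , f@(_ , _ , y∉B , _)) =
      let C , steps , stalled = go (B ∪ ⁅ y ⁆) (rs larger)
      in  C , force f ◅ steps , stalled
      where
      larger : (B ∪ ⁅ y ⁆) ⊃ B
      larger = p⊆p∪q ⁅ y ⁆ , y , q⊆p∪q B ⁅ y ⁆ (x∈⁅x⁆ y) , y∉B

  steps⊆stalled : ∀ {B C D} → Star Step B C → B ⊆ D → Stalled D → C ⊆ D
  steps⊆stalled ε B⊆D _ = B⊆D
  steps⊆stalled {B} {D = D} (force {x} {y} (x∈B , xy , _ , only) ◅ steps) B⊆D stalled =
    steps⊆stalled steps B∪y⊆D stalled
    where
    y∈D : y ∈ D
    y∈D with y ∈? D
    ... | yes y∈D = y∈D
    ... | no  y∉D = contradiction
      (B⊆D x∈B , xy , y∉D , λ z xz z∉D → only z xz (z∉D ∘ B⊆D)) (stalled x y)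

    B∪y⊆D : (B ∪ ⁅ y ⁆) ⊆ D
    B∪y⊆D z∈ with x∈p∪q⁻ B ⁅ y ⁆ z∈
    ... | inj₁ z∈B = B⊆D z∈B
    ... | inj₂ z∈y = subst (_∈ D) (sym (x∈⁅y⁆⇒x≡y y z∈y)) y∈D

  steps⊇ : ∀ {B C} → Star Step B C → B ⊆ C
  steps⊇ ε x∈B = x∈B
  steps⊇ (force {y = y} _ ◅ steps) x∈B = steps⊇ steps (p⊆p∪q ⁅ y ⁆ x∈B)

  -- The order in which forces are applied does not matter.

  closure-unique : ∀ {S C D} → IsClosure S C → IsClosure S D → C ≡ D
  closure-unique (S→C , C-stalled) (S→D , D-stalled) = ⊆-antisym
    (steps⊆stalled S→C (steps⊇ S→D) D-stalled)
    (steps⊆stalled S→D (steps⊇ S→C) C-stalled)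

  cl : Subset order → Subset order
  cl S = proj₁ (closure-exists S)

  cl-isClosure : ∀ S → IsClosure S (cl S)
  cl-isClosure S = proj₂ (closure-exists S)

  IsZeroForcing : Subset order → Set
  IsZeroForcing S = cl S ≡ ⊤

  isZeroForcing? : ∀ S → Dec (IsZeroForcing S)
  isZeroForcing? S = ≡-dec _≟ᵇ_ (cl S) ⊤

  ⊤-isZeroForcing : IsZeroForcing ⊤
  ⊤-isZeroForcing = ⊆-antisym (⊆-max _) (steps⊇ (proj₁ (cl-isClosure ⊤)))

  IsMinimumSize : ℕ → Set
  IsMinimumSize z =
    (∃[ S ] IsZeroForcing S × ∣ S ∣ ≡ z) × (∀ T → IsZeroForcing T → z ≤ ∣ T ∣)

  minimumSize-exists : ∃ IsMinimumSize
  minimumSize-exists = go ⊤ ⊤-isZeroForcing (<-wellFounded _)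
    where
    go : ∀ S → IsZeroForcing S → Acc _<_ ∣ S ∣ → ∃ IsMinimumSize
    go S zf (acc rs) with anySubset? (λ T → isZeroForcing? T ×-dec ∣ T ∣ <? ∣ S ∣)
    ... | yes (T , zfT , T<S) = go T zfT (rs T<S)
    ... | no  none = ∣ S ∣ , (S , zf , refl) , λ T zfT → ≮⇒≥ (λ T<S → none (T , zfT , T<S))

  Z : ℕ
  Z = proj₁ minimumSize-exists

  Z-isMinimumSize : IsMinimumSize Z
  Z-isMinimumSize = proj₂ minimumSize-exists

record Admissible (n k : ℕ) : Set where
  constructor admissible
  field
    3≤n  : 3 ≤ n
    1≤k  : 1 ≤ k
    2k<n : 2 * k < n

admissible-3 : ∀ {n} → 9 ≤ n → Admissible n 3
admissible-3 9≤n = admissible (≤-trans (m≤m+n 3 6) 9≤n) (s≤s z≤n) (≤-trans (m≤m+n 7 2) 9≤n)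

shift-≢ : ∀ {n m a} .{{_ : NonZero n}} → m < n → 0 < a → a < n → (m + a) % n ≢ m
shift-≢ {n} {m} {a} m<n 0<a a<n eq with m + a <? n
... | yes m+a<n = <⇒≢ 0<a (sym (+-cancelˡ-≡ m a 0
  (trans (sym (m<n⇒m%n≡m m+a<n)) (trans eq (+-comm 0 m)))))
... | no  m+a≮n = <⇒≢ a<n (+-cancelˡ-≡ m a n (begin
  m + a            ≡⟨ m+[n∸m]≡n n≤m+a ⟨
  n + (m + a ∸ n)  ≡⟨ cong (n +_) wrapped ⟩
  n + m            ≡⟨ +-comm n m ⟩
  m + n            ∎))
  where
  open ≡-Reasoning
  n≤m+a : n ≤ m + a
  n≤m+a = ≮⇒≥ m+a≮n
  small : m + a ∸ n < n
  small = m<n+o⇒m∸n<o (m + a) n (<-≤-trans (+-monoˡ-< a m<n) (+-monoʳ-≤ n (<⇒≤ a<n)))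
  wrapped : m + a ∸ n ≡ m
  wrapped = trans (sym (m<n⇒m%n≡m small)) (trans (m≤n⇒[n∸m]%m≡n%m n≤m+a) eq)

module GeneralizedPetersen (n k : ℕ) (ok : Admissible n k) where
  open Admissible ok

  private instance
    n-nonZero : NonZero n
    n-nonZero = >-nonZero (≤-trans (s≤s z≤n) 3≤n)

  infixl 6 _⊕_
  _⊕_ : Fin n → ℕ → Fin n
  i ⊕ a = (toℕ i + a) mod n

  -- inj₁ i is uᵢ and inj₂ i is vᵢ.

  data Edge : Fin n ⊎ Fin n → Fin n ⊎ Fin n → Set where
    outer : ∀ i → Edge (inj₁ i) (inj₁ (i ⊕ 1))
    spoke : ∀ i → Edge (inj₁ i) (inj₂ i)
    inner : ∀ i → Edge (inj₂ i) (inj₂ (i ⊕ k))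

  edge? : Decidable Edge
  edge? (inj₁ i) (inj₁ j) = map′ (λ { refl → outer i }) (λ { (outer _) → refl }) (i ⊕ 1 ≟ᶠ j)
  edge? (inj₁ i) (inj₂ j) = map′ (λ { refl → spoke i }) (λ { (spoke _) → refl }) (i ≟ᶠ j)
  edge? (inj₂ i) (inj₁ j) = no λ ()
  edge? (inj₂ i) (inj₂ j) = map′ (λ { refl → inner i }) (λ { (inner _) → refl }) (i ⊕ k ≟ᶠ j)

  ⊕-≢ : ∀ {a} i → 0 < a → a < n → i ⊕ a ≢ i
  ⊕-≢ {a} i 0<a a<n eq = shift-≢ (toℕ<n i) 0<a a<n
    (trans (sym (toℕ-fromℕ< (m%n<n (toℕ i + a) n))) (cong toℕ eq))

  edge-≢ : ∀ {x y} → Edge x y → x ≢ y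
  edge-≢ (outer i) eq = ⊕-≢ i (s≤s z≤n) (≤-trans (s≤s (s≤s z≤n)) 3≤n) (sym (inj₁-injective eq))
  edge-≢ (spoke i) ()
  edge-≢ (inner i) eq = ⊕-≢ i 1≤k (≤-<-trans (m≤m+n k _) 2k<n) (sym (inj₂-injective eq))

  P : Graph
  P = record
    { order  = n + n
    ; Adj    = λ x y → SymClosure Edge (splitAt n x) (splitAt n y)
    ; adj?   = λ x y → map′ (λ { (inj₁ e) → fwd e ; (inj₂ e) → bwd e })
                            (λ { (fwd e) → inj₁ e ; (bwd e) → inj₂ e })
                            (edge? (splitAt n x) (splitAt n y) ⊎-dec edge? (splitAt n y) (splitAt n x))
    ; symm   = symmetric Edge
    ; irrefl = λ { (fwd e) → edge-≢ e refl ; (bwd e) → edge-≢ e refl }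
    }

  u v : ℕ → Fin (n + n)
  u i = (i mod n) ↑ˡ n
  v i = n ↑ʳ (i mod n)

{-# OPTIONS --safe #-}

-- u₁,…,u₆ force v₁,…,v₆; then v₃ forces v₀ and v₄ forces v₇. Once all uᵢ and vᵢ with
-- i < m are black, for some m ≥ 8, u_{m-1} forces u_m and v_{m-3} forces v_m.
-- Instead of tracking the order of the forces, the argument uses only that the closure
-- is stalled: a black vertex cannot have exactly one white neighbour.

module Submission where

open import Defs
open import Data.Fin.Base using (Fin; toℕ; splitAt; _↑ˡ_; _↑ʳ_)
open import Data.Fin.Properties using (toℕ-fromℕ<; toℕ<n; toℕ-injective; splitAt-↑ˡ; splitAt-↑ʳ; splitAt⁻¹-↑ˡ; splitAt⁻¹-↑ʳ)
open import Data.Fin.Subset using (Subset; ⊤; inside; outside; _∈_; _∉_; _⊆_; _∪_; ∣_∣; ⁅_⁆; ⋃)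
open import Data.Fin.Subset.Properties using (_∈?_; ∣⊥∣≡0; ∣⁅x⁆∣≡1; p⊆p∪q; q⊆p∪q; x∈⁅x⁆; ⊆-antisym; ⊆-max)
open import Data.List.Base using ([]; _∷_; length; map; upTo)
open import Data.List.Membership.Propositional using () renaming (_∈_ to _∈ₗ_)
open import Data.List.Membership.Propositional.Properties using (∈-map⁺; ∈-upTo⁺)
open import Data.List.Relation.Unary.Any using (here; there)
open import Data.Nat.Base using (ℕ; zero; suc; _+_; _∸_; _≤_; _<_; z≤n; s≤s; NonZero; >-nonZero)
open import Data.Nat.DivMod using (_%_; _mod_; m%n<n; m<n⇒m%n≡m; m%n%n≡m%n; [m+n]%n≡m%n; %-distribˡ-+)
open import Data.Nat.Properties using (≤-refl; ≤-reflexive; ≤-trans; <⇒≤; +-comm; +-assoc; +-suc; +-mono-≤; m≤m+n; m≤n+m; m+[n∸m]≡n; m≤n⇒m≤1+n; m<1+n⇒m<n∨m≡n)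
open import Data.Product.Base using (_×_; _,_; proj₁; proj₂)
open import Data.Sum.Base using (_⊎_; inj₁; inj₂)
open import Data.Vec.Base using ([]; _∷_)
open import Relation.Binary.Construct.Closure.Symmetric using (SymClosure; fwd; bwd)
open import Relation.Binary.PropositionalEquality using (_≡_; refl; sym; trans; cong; subst; module ≡-Reasoning)
open import Relation.Nullary using (yes; no; contradiction)

-- Size and members of finite unions.

∣p∪q∣≤∣p∣+∣q∣ : ∀ {n} (p q : Subset n) → ∣ p ∪ q ∣ ≤ ∣ p ∣ + ∣ q ∣
∣p∪q∣≤∣p∣+∣q∣ []            []            = z≤n
∣p∪q∣≤∣p∣+∣q∣ (outside ∷ p) (outside ∷ q) = ∣p∪q∣≤∣p∣+∣q∣ p q
∣p∪q∣≤∣p∣+∣q∣ (outside ∷ p) (inside  ∷ q) =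
  ≤-trans (s≤s (∣p∪q∣≤∣p∣+∣q∣ p q)) (≤-reflexive (sym (+-suc ∣ p ∣ ∣ q ∣)))
∣p∪q∣≤∣p∣+∣q∣ (inside  ∷ p) (outside ∷ q) = s≤s (∣p∪q∣≤∣p∣+∣q∣ p q)
∣p∪q∣≤∣p∣+∣q∣ (inside  ∷ p) (inside  ∷ q) =
  s≤s (≤-trans (m≤n⇒m≤1+n (∣p∪q∣≤∣p∣+∣q∣ p q)) (≤-reflexive (sym (+-suc ∣ p ∣ ∣ q ∣))))

-- Each list entry contributes at most one vertex, and repeated values of `f` only shrink the union.
-- This bounds the size of the starting set by 8.
∣⋃⁅⁆∣≤length : ∀ {a n} {A : Set a} (f : A → Fin n) xs →
               ∣ ⋃ (map (λ x → ⁅ f x ⁆) xs) ∣ ≤ length xs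
∣⋃⁅⁆∣≤length {n = n} f []       = ≤-reflexive (∣⊥∣≡0 n)
∣⋃⁅⁆∣≤length         f (x ∷ xs) = ≤-trans (∣p∪q∣≤∣p∣+∣q∣ ⁅ f x ⁆ _)
  (+-mono-≤ (≤-reflexive (∣⁅x⁆∣≡1 (f x))) (∣⋃⁅⁆∣≤length f xs))

p∈ps⇒p⊆⋃ps : ∀ {n} {p : Subset n} {ps} → p ∈ₗ ps → p ⊆ ⋃ ps
p∈ps⇒p⊆⋃ps {ps = _ ∷ ps} (here refl)  x∈p = p⊆p∪q (⋃ ps) x∈p
p∈ps⇒p⊆⋃ps {ps = q ∷ ps} (there p∈ps) x∈p = q⊆p∪q q (⋃ ps) (p∈ps⇒p⊆⋃ps p∈ps x∈p)

module _ (G : Graph) where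
  open Graph G
  open ZeroForcing G

  -- If `y` were white, `x` would force it. The premise on the other neighbours is a disjunction so
  -- that it can be read off from a list of neighbours.
  stalled⇒last-neighbour∈ : ∀ {B x y} → Stalled B → x ∈ B → Adj x y →
                            (∀ {z} → Adj x z → z ≡ y ⊎ z ∈ B) → y ∈ B
  stalled⇒last-neighbour∈ {B} {x} {y} stalled x∈B xy others with y ∈? B
  ... | yes y∈B = y∈B
  ... | no  y∉B = contradiction (x∈B , xy , y∉B , only) (stalled x y)
    where
    only : ∀ z → Adj x z → z ∉ B → z ≡ y
    only z xz z∉B with others xz
    ... | inj₁ z≡y = z≡y
    ... | inj₂ z∈B = contradiction z∈B z∉B

module _ (n k : ℕ) (ok : Admissible n k) where
  open Admissible ok
  open GeneralizedPetersen n k ok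
  open Graph P

  private instance
    n-nonZero : NonZero n
    n-nonZero = >-nonZero (≤-trans (s≤s z≤n) 3≤n)

  -- Index arithmetic modulo `n`.

  toℕ-mod : ∀ i → toℕ (i mod n) ≡ i % n
  toℕ-mod i = toℕ-fromℕ< (m%n<n i n)

  mod-cong : ∀ {i j} → i % n ≡ j % n → i mod n ≡ j mod n
  mod-cong {i} {j} eq = toℕ-injective (trans (toℕ-mod i) (trans eq (sym (toℕ-mod j))))

  toℕ-mod-inverse : ∀ (i : Fin n) → toℕ i mod n ≡ i
  toℕ-mod-inverse i = toℕ-injective (trans (toℕ-mod (toℕ i)) (m<n⇒m%n≡m (toℕ<n i)))

  -- The shift is written on the left of the sum so that, for a numeral `a`, the index computes to
  -- successors: `1 + (1 + i)` is `2 + i` by definition.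
  mod-⊕ : ∀ i a → (i mod n) ⊕ a ≡ (a + i) mod n
  mod-⊕ i a = mod-cong (begin
    (toℕ (i mod n) + a) % n    ≡⟨ cong (λ r → (r + a) % n) (toℕ-mod i) ⟩
    (i % n + a) % n            ≡⟨ %-distribˡ-+ (i % n) a n ⟩
    (i % n % n + a % n) % n    ≡⟨ cong (λ r → (r + a % n) % n) (m%n%n≡m%n i n) ⟩
    (i % n + a % n) % n        ≡⟨ %-distribˡ-+ i a n ⟨
    (i + a) % n                ≡⟨ cong (_% n) (+-comm i a) ⟩
    (a + i) % n                ∎)
    where open ≡-Reasoning

  -- The two shifts together make one full turn of the cycle.
  ⊕-inverse : ∀ {a} → a ≤ n → ∀ i → (i ⊕ a) ⊕ (n ∸ a) ≡ i
  ⊕-inverse {a} a≤n i = begin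
    (i ⊕ a) ⊕ (n ∸ a)               ≡⟨ mod-⊕ (toℕ i + a) (n ∸ a) ⟩
    (n ∸ a + (toℕ i + a)) mod n     ≡⟨ mod-cong (cong (_% n) (+-comm (n ∸ a) (toℕ i + a))) ⟩
    (toℕ i + a + (n ∸ a)) mod n     ≡⟨ mod-cong (cong (_% n) (+-assoc (toℕ i) a (n ∸ a))) ⟩
    (toℕ i + (a + (n ∸ a))) mod n   ≡⟨ mod-cong (cong (λ b → (toℕ i + b) % n) (m+[n∸m]≡n a≤n)) ⟩
    (toℕ i + n) mod n               ≡⟨ mod-cong ([m+n]%n≡m%n (toℕ i) n) ⟩
    toℕ i mod n                     ≡⟨ toℕ-mod-inverse i ⟩
    i                               ∎
    where open ≡-Reasoning

  ⊕-injective : ∀ {a i j} → a ≤ n → i ⊕ a ≡ j ⊕ a → i ≡ j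
  ⊕-injective {a} {i} {j} a≤n eq =
    trans (sym (⊕-inverse a≤n i)) (trans (cong (_⊕ (n ∸ a)) eq) (⊕-inverse a≤n j))

  -- Serves edges traversed backwards: such an edge determines only the shifted index `j ⊕ a`, from
  -- which `j` must be recovered.
  ⊕-mod⁻ : ∀ {a i} j → a ≤ n → j ⊕ a ≡ (a + i) mod n → j ≡ i mod n
  ⊕-mod⁻ {a} {i} j a≤n eq = ⊕-injective a≤n (trans eq (sym (mod-⊕ i a)))

  1≤n : 1 ≤ n
  1≤n = ≤-trans (s≤s z≤n) 3≤n

  k≤n : k ≤ n
  k≤n = ≤-trans (m≤m+n k _) (<⇒≤ 2k<n)

  -- Edges and neighbourhoods.

  u∼u : ∀ i → Adj (u i) (u (1 + i))
  u∼u i rewrite splitAt-↑ˡ n (i mod n) n | splitAt-↑ˡ n ((1 + i) mod n) n | sym (mod-⊕ i 1) =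
    fwd (outer (i mod n))

  u∼v : ∀ i → Adj (u i) (v i)
  u∼v i rewrite splitAt-↑ˡ n (i mod n) n | splitAt-↑ʳ n n (i mod n) = fwd (spoke (i mod n))

  v∼v : ∀ i → Adj (v i) (v (k + i))
  v∼v i rewrite splitAt-↑ʳ n n (i mod n) | splitAt-↑ʳ n n ((k + i) mod n) | sym (mod-⊕ i k) =
    fwd (inner (i mod n))

  -- Centring at `1 + i` names the preceding vertex `u i` without subtraction; `v-neighbours` is
  -- centred at `k + i` for the same reason.
  u-neighbours : ∀ i {z} → Adj (u (1 + i)) z → z ≡ u i ⊎ z ≡ u (2 + i) ⊎ z ≡ v (1 + i)
  u-neighbours i {z} adj rewrite splitAt-↑ˡ n ((1 + i) mod n) n = go _ refl refl adj
    where
    -- The endpoints become variables tied down by equations: in the case `bwd (outer j)` the centre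
    -- is `j ⊕ 1`, which does not unify with `(1 + i) mod n`.
    go : ∀ {r} s → splitAt n z ≡ s → r ≡ (1 + i) mod n → SymClosure Edge (inj₁ r) s →
         z ≡ u i ⊎ z ≡ u (2 + i) ⊎ z ≡ v (1 + i)
    go _ eq r≡ (fwd (outer _)) =
      inj₂ (inj₁ (trans (sym (splitAt⁻¹-↑ˡ eq))
        (cong (_↑ˡ n) (trans (cong (_⊕ 1) r≡) (mod-⊕ (1 + i) 1)))))
    go _ eq r≡ (fwd (spoke _)) = inj₂ (inj₂ (trans (sym (splitAt⁻¹-↑ʳ eq)) (cong (n ↑ʳ_) r≡)))
    go _ eq r≡ (bwd (outer j)) =
      inj₁ (trans (sym (splitAt⁻¹-↑ˡ eq)) (cong (_↑ˡ n) (⊕-mod⁻ j 1≤n r≡)))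

  v-neighbours : ∀ i {z} → Adj (v (k + i)) z → z ≡ v i ⊎ z ≡ v (k + (k + i)) ⊎ z ≡ u (k + i)
  v-neighbours i {z} adj rewrite splitAt-↑ʳ n n ((k + i) mod n) = go _ refl refl adj
    where
    go : ∀ {r} s → splitAt n z ≡ s → r ≡ (k + i) mod n → SymClosure Edge (inj₂ r) s →
         z ≡ v i ⊎ z ≡ v (k + (k + i)) ⊎ z ≡ u (k + i)
    go _ eq r≡ (fwd (inner _)) =
      inj₂ (inj₁ (trans (sym (splitAt⁻¹-↑ʳ eq))
        (cong (n ↑ʳ_) (trans (cong (_⊕ k) r≡) (mod-⊕ (k + i) k)))))
    go _ eq r≡ (bwd (spoke _)) = inj₂ (inj₂ (trans (sym (splitAt⁻¹-↑ˡ eq)) (cong (_↑ˡ n) r≡)))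
    go _ eq r≡ (bwd (inner j)) =
      inj₁ (trans (sym (splitAt⁻¹-↑ʳ eq)) (cong (n ↑ʳ_) (⊕-mod⁻ j k≤n r≡)))

  -- Here `i` runs over all natural numbers, since `u` and `v` reduce it modulo `n`. An induction on
  -- indices therefore never has to treat the wrap-around.
  all-u-v∈⇒⊤ : ∀ {B} → (∀ i → u i ∈ B × v i ∈ B) → B ≡ ⊤
  all-u-v∈⇒⊤ {B} black = ⊆-antisym (⊆-max B) (λ {x} _ → x∈B x)
    where
    x∈B : ∀ x → x ∈ B
    x∈B x with splitAt n x in eq
    ... | inj₁ i = subst (_∈ B)
      (trans (cong (_↑ˡ n) (toℕ-mod-inverse i)) (splitAt⁻¹-↑ˡ eq)) (proj₁ (black (toℕ i)))
    ... | inj₂ i = subst (_∈ B)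
      (trans (cong (n ↑ʳ_) (toℕ-mod-inverse i)) (splitAt⁻¹-↑ʳ eq)) (proj₂ (black (toℕ i)))

  -- Single forces in a stalled colouring.

  module _ {B : Subset (n + n)} (stalled : ZeroForcing.Stalled P B) where

    u-forces-u : ∀ i → u i ∈ B → u (1 + i) ∈ B → v (1 + i) ∈ B → u (2 + i) ∈ B
    u-forces-u i ui u1+i v1+i =
      stalled⇒last-neighbour∈ P stalled u1+i (u∼u (1 + i)) λ adj → others (u-neighbours i adj)
      where
      others : ∀ {z} → z ≡ u i ⊎ z ≡ u (2 + i) ⊎ z ≡ v (1 + i) → z ≡ u (2 + i) ⊎ z ∈ B
      others (inj₁ refl)        = inj₂ ui
      others (inj₂ (inj₁ eq))   = inj₁ eq
      others (inj₂ (inj₂ refl)) = inj₂ v1+i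

    u-forces-v : ∀ i → u i ∈ B → u (1 + i) ∈ B → u (2 + i) ∈ B → v (1 + i) ∈ B
    u-forces-v i ui u1+i u2+i =
      stalled⇒last-neighbour∈ P stalled u1+i (u∼v (1 + i)) λ adj → others (u-neighbours i adj)
      where
      others : ∀ {z} → z ≡ u i ⊎ z ≡ u (2 + i) ⊎ z ≡ v (1 + i) → z ≡ v (1 + i) ⊎ z ∈ B
      others (inj₁ refl)        = inj₂ ui
      others (inj₂ (inj₁ refl)) = inj₂ u2+i
      others (inj₂ (inj₂ eq))   = inj₁ eq

    v-forces-next : ∀ i → v i ∈ B → v (k + i) ∈ B → u (k + i) ∈ B → v (k + (k + i)) ∈ B
    v-forces-next i vi vk+i uk+i =
      stalled⇒last-neighbour∈ P stalled vk+i (v∼v (k + i)) λ adj → others (v-neighbours i adj)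
      where
      others : ∀ {z} → z ≡ v i ⊎ z ≡ v (k + (k + i)) ⊎ z ≡ u (k + i) →
               z ≡ v (k + (k + i)) ⊎ z ∈ B
      others (inj₁ refl)        = inj₂ vi
      others (inj₂ (inj₁ eq))   = inj₁ eq
      others (inj₂ (inj₂ refl)) = inj₂ uk+i

    v-forces-previous : ∀ i → v (k + i) ∈ B → v (k + (k + i)) ∈ B → u (k + i) ∈ B → v i ∈ B
    v-forces-previous i vk+i v2k+i uk+i =
      -- The edge from `v∼v` points upwards and is reversed here. Its endpoints are given explicitly
      -- because `Adj` sees them only through `splitAt`.
      stalled⇒last-neighbour∈ P stalled vk+i (symm {v i} {v (k + i)} (v∼v i))
        λ adj → others (v-neighbours i adj)
      where
      others : ∀ {z} → z ≡ v i ⊎ z ≡ v (k + (k + i)) ⊎ z ≡ u (k + i) → z ≡ v i ⊎ z ∈ B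
      others (inj₁ eq)          = inj₁ eq
      others (inj₂ (inj₁ refl)) = inj₂ v2k+i
      others (inj₂ (inj₂ refl)) = inj₂ uk+i

-- The induction for inner step 3.

module _ (n : ℕ) (ok : Admissible n 3) where
  open GeneralizedPetersen n 3 ok
  open ZeroForcing P

  stalled∧u₀…u₇∈⇒⊤ : ∀ {B} → Stalled B → (∀ {i} → i < 8 → u i ∈ B) → B ≡ ⊤
  stalled∧u₀…u₇∈⇒⊤ {B} stalled u∈B =
    all-u-v∈⇒⊤ n 3 ok λ i → u,v∈B i (s≤s (m≤n+m i 7))
    where
    -- The bound 6 keeps `i`, `1 + i` and `2 + i` below 8.
    v₁₊ᵢ∈B : ∀ i → i < 6 → v (1 + i) ∈ B
    v₁₊ᵢ∈B i i<6 = u-forces-v n 3 ok stalled i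
      (u∈B (≤-trans i<6 (m≤m+n 6 2))) (u∈B (≤-trans (s≤s i<6) (m≤m+n 7 1))) (u∈B (s≤s (s≤s i<6)))

    v∈B : ∀ {i} → i < 8 → v i ∈ B
    -- The forcing vertex is v₃, whose other neighbours v₆ and u₃ are black.
    v∈B {zero} _ = v-forces-previous n 3 ok stalled 0
      (v₁₊ᵢ∈B 2 (m≤m+n 3 3)) (v₁₊ᵢ∈B 5 ≤-refl) (u∈B (m≤m+n 4 4))
    v∈B {suc i} (s≤s i<7) with m<1+n⇒m<n∨m≡n i<7
    ... | inj₁ i<6  = v₁₊ᵢ∈B i i<6
    -- The remaining index is 7: v₄ forces v₇, as v₁ and u₄ are black.
    ... | inj₂ refl = v-forces-next n 3 ok stalled 1
      (v₁₊ᵢ∈B 0 (m≤m+n 1 5)) (v₁₊ᵢ∈B 3 (m≤m+n 4 2)) (u∈B (m≤m+n 5 3))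

    -- All indices below `8 + m` are carried along, because a new inner vertex depends on indices up
    -- to six lower.
    u,v∈B : ∀ m {i} → i < 8 + m → u i ∈ B × v i ∈ B
    u,v∈B zero    i<8   = u∈B i<8 , v∈B i<8
    u,v∈B (suc m) i<9+m with m<1+n⇒m<n∨m≡n i<9+m
    ... | inj₁ i<8+m = u,v∈B m i<8+m
    -- The new index is `8 + m`. Its outer vertex is forced by `u (7 + m)`, its inner vertex by
    -- `v (5 + m)`, whose other neighbours are `v (2 + m)` and `u (5 + m)`.
    ... | inj₂ refl  =
      u-forces-u n 3 ok stalled (6 + m)
        (proj₁ (black 6 (m≤m+n 7 1))) (proj₁ (black 7 ≤-refl)) (proj₂ (black 7 ≤-refl)) ,
      v-forces-next n 3 ok stalled (2 + m)
        (proj₂ (black 2 (m≤m+n 3 5))) (proj₂ (black 5 (m≤m+n 6 2))) (proj₁ (black 5 (m≤m+n 6 2)))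
      where
      black : ∀ j → j < 8 → u (j + m) ∈ B × v (j + m) ∈ B
      black j j<8 = u,v∈B m (+-mono-≤ j<8 (≤-refl {m}))

proposition4 : (n : ℕ) (9≤n : 9 ≤ n) →
    let open GeneralizedPetersen n 3 (admissible-3 9≤n)
        open ZeroForcing P
    in IsZeroForcing (⋃ (map (λ i → ⁅ u i ⁆) (upTo 8))) × Z ≤ 8
proposition4 n 9≤n =
  zeroForcing , ≤-trans (proj₂ Z-isMinimumSize S zeroForcing) (∣⋃⁅⁆∣≤length u (upTo 8))
  where
  open GeneralizedPetersen n 3 (admissible-3 9≤n)
  open ZeroForcing P

  S : Subset (n + n)
  S = ⋃ (map (λ i → ⁅ u i ⁆) (upTo 8))

  u∈S : ∀ {i} → i < 8 → u i ∈ S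
  u∈S {i} i<8 = p∈ps⇒p⊆⋃ps (∈-map⁺ (λ i → ⁅ u i ⁆) (∈-upTo⁺ i<8)) (x∈⁅x⁆ (u i))

  zeroForcing : IsZeroForcing S
  zeroForcing = let S→cl , stalled = cl-isClosure S in
    stalled∧u₀…u₇∈⇒⊤ n (admissible-3 9≤n) stalled λ i<8 → steps⊇ S→cl (u∈S i<8)
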